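{- Let $(F_n)_{n\ge1}$ be the Fibonacci numbers $F_1=1$, $F_2=2$, $F_n=F_{n-1}+F_{n-2}$ for $n\ge 3$. For each of the following sets $P$ of generalized patterns, $|S_n(P)|=F_n$ for every $n\ge1$: $\{1\text{ - }23,2\text{ - }13,1\text{ - }32,21\text{ - }3\}$, $\{1\text{ - }23,2\text{ - }13,1\text{ - }32,12\text{ - }3\}$, $\{1\text{ - }23,2\text{ - }13,13\text{ - }2,21\text{ - }3\}$, $\{1\text{ - }23,2\text{ - }13,13\text{ - }2,1\text{ - }32\}$, $\{1\text{ - }23,2\text{ - }13,13\text{ - }2,12\text{ - }3\}$, $\{1\text{ - }23,21\text{ - }3,13\text{ - }2,1\text{ - }32\}$, $\{1\text{ - }23,13\text{ - }2,3\text{ - }12,1\text{ - }32\}$, $\{1\text{ - }23,1\text{ - }32,31\text{ - }2,3\text{ - }12\}$, $\{1\text{ - }23,13\text{ - }2,31\text{ - }2,1\text{ - }32\}$, $\{1\text{ - }23,13\text{ - }2,31\text{ - }2,3\text{ - }12\}$.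
   Context: $S_n$ is the set of permutations $\pi=\pi_1\pi_2\cdots\pi_n$ of $\{1,\dots,n\}$. For $abc$ a permutation of $123$, the generalized pattern $a\text{ - }bc$ is contained in $\pi$ if there are indices $i<j$ with $j+1\le n$ such that $\pi_i\pi_j\pi_{j+1}$ is order-isomorphic to $abc$; the generalized pattern $ab\text{ - }c$ is contained in $\pi$ if there are indices $i,k$ with $i+1<k\le n$ such that $\pi_i\pi_{i+1}\pi_k$ is order-isomorphic to $abc$. (Letters not separated by a dash must occur in adjacent positions; letters separated by a dash need not be adjacent.) $\pi$ avoids a pattern if it does not contain it. For a set $P$ of generalized patterns, $S_n(P)$ is the set of $\pi\in S_n$ avoiding every pattern in $P$. -}

module Defs where

open import Level using (0ℓ)
open import Data.Nat.Base using (ℕ; zero; suc; _+_; _<_)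
open import Data.Fin.Base as Fin using (Fin; toℕ)
open import Data.Fin.Permutation using (Permutation′; _⟨$⟩ʳ_)
open import Data.List.Base using (List)
open import Data.List.Relation.Unary.All using (All)
open import Data.Product.Base using (Σ-syntax; ∃-syntax; _×_; proj₁)
open import Data.Vec.Base using (Vec; []; _∷_; lookup)
open import Function.Base using (_∘_)
open import Function.Bundles using (Inverse; _⇔_)
open import Relation.Binary.Bundles using (Setoid)
import Relation.Binary.Construct.On as On
open import Relation.Binary.PropositionalEquality using (_≡_; setoid; _→-setoid_)
open import Relation.Nullary.Negation using (¬_)

-- The generalized pattern a-bc is written  a - b ∙ c , and ab-c is written
-- a ∙ b - c ; letters joined by ∙ must occur in adjacent positions.
infix 6 _-_∙_ _∙_-_

data Pattern : Set where
  _-_∙_ : (a b c : ℕ) → Pattern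
  _∙_-_ : (a b c : ℕ) → Pattern

1-23 1-32 2-13 3-12 12-3 13-2 21-3 31-2 : Pattern
1-23 = 1 - 2 ∙ 3
1-32 = 1 - 3 ∙ 2
2-13 = 2 - 1 ∙ 3
3-12 = 3 - 1 ∙ 2
12-3 = 1 ∙ 2 - 3
13-2 = 1 ∙ 3 - 2
21-3 = 2 ∙ 1 - 3
31-2 = 3 ∙ 1 - 2

OrderIsomorphic : ∀ {k} → Vec ℕ k → Vec ℕ k → Set
OrderIsomorphic u v =
  ∀ s t → lookup u s < lookup u t ⇔ lookup v s < lookup v t

-- Positions and values of a permutation are numbered from 0 rather than 1.
_Contains_ : ∀ {n} → Permutation′ n → Pattern → Set
_Contains_ {n} π (a - b ∙ c) =
  ∃[ i ] ∃[ j ] ∃[ k ]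
    i Fin.< j × toℕ k ≡ suc (toℕ j) ×
    OrderIsomorphic (value i ∷ value j ∷ value k ∷ []) (a ∷ b ∷ c ∷ [])
  where
  value : Fin n → ℕ
  value x = toℕ (π ⟨$⟩ʳ x)
_Contains_ {n} π (a ∙ b - c) =
  ∃[ i ] ∃[ j ] ∃[ k ]
    toℕ j ≡ suc (toℕ i) × j Fin.< k ×
    OrderIsomorphic (value i ∷ value j ∷ value k ∷ []) (a ∷ b ∷ c ∷ [])
  where
  value : Fin n → ℕ
  value x = toℕ (π ⟨$⟩ʳ x)

_Avoids_ : ∀ {n} → Permutation′ n → Pattern → Set
π Avoids p = ¬ (π Contains p)

-- The equality compares the underlying functions only: neither the chosen
-- inverses nor the proofs of avoidance distinguish elements.
S : ℕ → List Pattern → Setoid 0ℓ 0ℓ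
S n P = On.setoid
  {B = Σ[ π ∈ Permutation′ n ] All (π Avoids_) P}
  (Fin n →-setoid Fin n)
  (_⟨$⟩ʳ_ ∘ proj₁)

HasCardinality : Setoid 0ℓ 0ℓ → ℕ → Set
HasCardinality A m = Inverse A (setoid (Fin m))

-- F 1 = 1 and F 2 = 2; the value at 0 extends the recurrence backwards.
F : ℕ → ℕ
F zero          = 1
F (suc zero)    = 1
F (suc (suc n)) = F (suc n) + F n

{-# OPTIONS --safe #-}

-- For each of the ten sets P, a permutation (with values numbered from 0)
-- avoids P exactly when its last entry is 0, or its last two entries are 0 m,
-- and the remaining entries, standardised, avoid P again; here m is the value 1
-- for the first six sets and the largest value for the other four.  Indeed an
-- entry 0 followed by two adjacent entries gives 1-23 or 1-32, and a wrong
-- entry after a penultimate 0 gives 2-13 or 3-12; where P lacks one of these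
-- patterns, its absence follows by choosing adjacent entries at which the word
-- leaves a set of values.  So these permutations are
-- coded by the tilings of a strip of length n by squares and dominoes.

module Submission where

open import Defs
open import Data.Fin.Base as Fin
  using (Fin; zero; suc; toℕ; fromℕ; inject₁; punchIn)
open import Data.Fin.Induction using (<-weakInduction-startingFrom)
open import Data.Fin.Patterns using (0F; 1F; 2F)
open import Data.Fin.Permutation
  using (Permutation′; _⟨$⟩ʳ_; _⟨$⟩ˡ_; id; insert; remove; _≈_; inverseˡ; inverseʳ;
         insert-punchIn; insert-remove; punchIn-permute)
open import Data.Fin.Properties
  using (_≟_; toℕ-fromℕ; toℕ-inject₁; toℕ-injective; inject₁ℕ<;
         ≤fromℕ; punchIn-injective; punchIn-mono-≤;
         punchIn-cancel-≤; +↔⊎; <-trans; <⇒≢)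
open import Data.Fin.Relation.Unary.Top using (view; ‵fromℕ; ‵inject₁)
open import Data.List.Base using (List; []; _∷_)
open import Data.List.Relation.Unary.All as All using (All; []; _∷_; all?)
open import Data.Nat.Base using (ℕ; zero; suc; _≤_; _<_; z≤n; s≤s; s≤s⁻¹)
import Data.Nat.Properties as ℕ
open import Data.Product.Base using (∃-syntax; _×_; _,_; proj₁; proj₂)
open import Data.Sum.Base using (_⊎_; inj₁; inj₂)
open import Data.Sum.Function.Propositional using (_⊎-↔_)
open import Data.Vec.Base using (Vec; []; _∷_; lookup; map)
open import Data.Vec.Properties using (lookup-map)
open import Function.Base using (_∘_)
open import Function.Bundles
  using (Bijection; Equivalence; _⇔_; _↔_; mk⇔; mk↔ₛ′)
open import Function.Construct.Composition as Composition using (_⇔-∘_)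
open import Function.Construct.Symmetry as Symmetry using (⇔-sym)
open import Function.Properties.Bijection using (Bijection⇒Inverse)
open import Function.Properties.Inverse using (↔-sym; ↔-trans)
open import Relation.Binary.Definitions using (tri<; tri≈; tri>)
open import Relation.Binary.PropositionalEquality
  using (_≡_; _≢_; refl; sym; trans; cong; subst; setoid)
open import Relation.Nullary.Decidable using (True; yes; no; from-yes; toWitness; _×-dec_; _⊎-dec_)
open import Relation.Nullary.Negation using (¬_; contradiction)
open import Relation.Unary using (Pred; Decidable)

private
  variable
    k n : ℕ
    p : Pattern
    P : List Pattern

-- Order isomorphism

letters : Pattern → Vec ℕ 3
letters (a - b ∙ c) = a ∷ b ∷ c ∷ []
letters (a ∙ b - c) = a ∷ b ∷ c ∷ []

lookup-increasing : ∀ {x y z} → x < y → y < z →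
  ∀ {s t} → s Fin.< t → lookup (x ∷ y ∷ z ∷ []) s < lookup (x ∷ y ∷ z ∷ []) t
lookup-increasing x<y y<z {0F} {1F} _ = x<y
lookup-increasing x<y y<z {0F} {2F} _ = ℕ.<-trans x<y y<z
lookup-increasing x<y y<z {1F} {1F} (s≤s ())
lookup-increasing x<y y<z {1F} {2F} _ = y<z
lookup-increasing x<y y<z {2F} {1F} (s≤s ())
lookup-increasing x<y y<z {2F} {2F} (s≤s (s≤s ()))

lookup-increasing⁻¹ : ∀ {x y z} → x < y → y < z →
  ∀ {s t} → lookup (x ∷ y ∷ z ∷ []) s < lookup (x ∷ y ∷ z ∷ []) t → s Fin.< t
lookup-increasing⁻¹ x<y y<z {s} {t} lt with ℕ.<-cmp (toℕ s) (toℕ t)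
... | tri< s<t _ _ = s<t
... | tri≈ _ s≡t _ with refl ← toℕ-injective s≡t = contradiction lt (ℕ.<-irrefl refl)
... | tri> _ _ t<s = contradiction (lookup-increasing x<y y<z t<s) (ℕ.<-asym lt)

-- Pattern letters start at 1, while the indices in `Fin 3` start at 0.
rank : Fin 3 → ℕ
rank s = suc (toℕ s)

-- Both words read an increasing triple along the same `σ`, so comparisons in either reduce to
-- comparisons of indices. Every occurrence exhibited below is built this way: `σ` is the pattern
-- with its letters counted from 0.
arrangement : ∀ {x y z} → x < y → y < z → (σ : Vec (Fin 3) k) →
  OrderIsomorphic (map (lookup (x ∷ y ∷ z ∷ [])) σ) (map rank σ)
arrangement {x = x} {y} {z} x<y y<z σ s t
  rewrite lookup-map s (lookup (x ∷ y ∷ z ∷ [])) σ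
        | lookup-map t (lookup (x ∷ y ∷ z ∷ [])) σ
        | lookup-map s rank σ
        | lookup-map t rank σ
  = mk⇔ (s≤s ∘ lookup-increasing⁻¹ x<y y<z) (lookup-increasing x<y y<z ∘ s≤s⁻¹)

punchIn-< : ∀ v (x y : Fin n) → (punchIn v x Fin.< punchIn v y) ⇔ (x Fin.< y)
punchIn-< v x y = mk⇔
  (λ lt → ℕ.≰⇒> (ℕ.<⇒≱ lt ∘ punchIn-mono-≤ v y x))
  (λ lt → ℕ.≰⇒> (ℕ.<⇒≱ lt ∘ punchIn-cancel-≤ v y x))

-- `punchIn v` preserves and reflects the strict order, so making room for a new value `v`, or
-- closing the gap it leaves, does not disturb the relative order of the other entries.
OrderIsomorphic-punchIn : ∀ v (xs : Vec (Fin n) k) {w} →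
  OrderIsomorphic (map toℕ (map (punchIn v) xs)) w ⇔ OrderIsomorphic (map toℕ xs) w
OrderIsomorphic-punchIn v xs = mk⇔
  (λ iso s t → iso s t ⇔-∘ ⇔-sym (comparison s t))
  (λ iso s t → iso s t ⇔-∘ comparison s t)
  where
  entry : ∀ s → lookup (map toℕ (map (punchIn v) xs)) s ≡ toℕ (punchIn v (lookup xs s))
  entry s = trans (lookup-map s toℕ (map (punchIn v) xs)) (cong toℕ (lookup-map s (punchIn v) xs))

  comparison : ∀ s t →
    (lookup (map toℕ (map (punchIn v) xs)) s < lookup (map toℕ (map (punchIn v) xs)) t) ⇔
    (lookup (map toℕ xs) s < lookup (map toℕ xs) t)
  comparison s t rewrite entry s | entry t | lookup-map s toℕ xs | lookup-map t toℕ xs =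
    punchIn-< v (lookup xs s) (lookup xs t)

-- Occurrences of patterns

-- Treats both places of the dash uniformly. Natural numbers instead of `Fin` let positions in words
-- of different lengths be compared directly.
Positions : Pattern → ℕ → ℕ → ℕ → Set
Positions (_ - _ ∙ _) i j k = i < j × k ≡ suc j
Positions (_ ∙ _ - _) i j k = j ≡ suc i × j < k

positions-< : ∀ p {i j k} → Positions p i j k → i < j × j < k
positions-< (_ - _ ∙ _) (i<j , refl) = i<j , ℕ.n<1+n _
positions-< (_ ∙ _ - _) (refl , j<k) = ℕ.n<1+n _ , j<k

Occurrence : Permutation′ n → Pattern → Set
Occurrence π p = ∃[ i ] ∃[ j ] ∃[ k ]
  Positions p (toℕ i) (toℕ j) (toℕ k) ×
  OrderIsomorphic (map toℕ (map (π ⟨$⟩ʳ_) (i ∷ j ∷ k ∷ []))) (letters p)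

contains⇒occurrence : ∀ (π : Permutation′ n) p → π Contains p → Occurrence π p
contains⇒occurrence π (_ - _ ∙ _) (i , j , k , i<j , eq , iso) = i , j , k , (i<j , eq) , iso
contains⇒occurrence π (_ ∙ _ - _) (i , j , k , eq , j<k , iso) = i , j , k , (eq , j<k) , iso

occurrence⇒contains : ∀ (π : Permutation′ n) p → Occurrence π p → π Contains p
occurrence⇒contains π (_ - _ ∙ _) (i , j , k , (i<j , eq) , iso) = i , j , k , i<j , eq , iso
occurrence⇒contains π (_ ∙ _ - _) (i , j , k , (eq , j<k) , iso) = i , j , k , eq , j<k , iso

-- Deleting and inserting the last entry

punchIn-fromℕ : (i : Fin n) → punchIn (fromℕ n) i ≡ inject₁ i
punchIn-fromℕ zero    = refl
punchIn-fromℕ (suc i) = cong suc (punchIn-fromℕ i)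

-- Opaque, because otherwise conversion checking unfolds nested insertions.
opaque
  insertLast : Fin (suc n) → Permutation′ n → Permutation′ (suc n)
  insertLast {n} = insert (fromℕ n)

  removeLast : Permutation′ (suc n) → Permutation′ n
  removeLast {n} = remove (fromℕ n)

  insertLast-last : ∀ v (π : Permutation′ n) → insertLast v π ⟨$⟩ʳ fromℕ n ≡ v
  insertLast-last {n} v π with fromℕ n ≟ fromℕ n
  ... | yes _   = refl
  ... | no  neq = contradiction refl neq

  insertLast-inject₁ : ∀ v (π : Permutation′ n) i →
    insertLast v π ⟨$⟩ʳ inject₁ i ≡ punchIn v (π ⟨$⟩ʳ i)
  insertLast-inject₁ {n} v π i =
    subst (λ x → insertLast v π ⟨$⟩ʳ x ≡ punchIn v (π ⟨$⟩ʳ i)) (punchIn-fromℕ i)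
      (insert-punchIn (fromℕ n) v π i)

  removeLast-inject₁ : ∀ (π : Permutation′ (suc n)) i →
    π ⟨$⟩ʳ inject₁ i ≡ punchIn (π ⟨$⟩ʳ fromℕ n) (removeLast π ⟨$⟩ʳ i)
  removeLast-inject₁ {n} π i =
    trans (cong (π ⟨$⟩ʳ_) (sym (punchIn-fromℕ i))) (punchIn-permute π (fromℕ n) i)

  insertLast-cong : ∀ {v w} {π ρ : Permutation′ n} → v ≡ w → π ≈ ρ → insertLast v π ≈ insertLast w ρ
  insertLast-cong {n} refl π≈ρ i with fromℕ n ≟ i
  ... | yes _ = refl
  ... | no  _ = cong (punchIn _) (π≈ρ _)

  insertLast-removeLast : ∀ {v} (π : Permutation′ (suc n)) {ρ : Permutation′ n} →
    π ⟨$⟩ʳ fromℕ n ≡ v → ρ ≈ removeLast π → insertLast v ρ ≈ π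
  insertLast-removeLast {n} π last ρ≈ i =
    trans (insertLast-cong (sym last) ρ≈ i) (insert-remove (fromℕ n) π i)

insertLast-injective : ∀ {v w} {π ρ : Permutation′ n} → insertLast v π ≈ insertLast w ρ → v ≡ w × π ≈ ρ
insertLast-injective {n} {v} {w} {π} {ρ} eq = v≡w , λ i →
  punchIn-injective w _ _ (trans (cong (λ u → punchIn u (π ⟨$⟩ʳ i)) (sym v≡w))
    (trans (sym (insertLast-inject₁ v π i)) (trans (eq (inject₁ i)) (insertLast-inject₁ w ρ i))))
  where
  v≡w : v ≡ w
  v≡w = trans (sym (insertLast-last v π)) (trans (eq (fromℕ n)) (insertLast-last w ρ))

positions-inject₁ : ∀ p (i j k : Fin n) →
  Positions p (toℕ (inject₁ i)) (toℕ (inject₁ j)) (toℕ (inject₁ k)) ≡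
  Positions p (toℕ i) (toℕ j) (toℕ k)
positions-inject₁ p i j k rewrite toℕ-inject₁ i | toℕ-inject₁ j | toℕ-inject₁ k = refl

-- Positions in a prefix are adjacent exactly when they are adjacent in the whole word, so an
-- occurrence in the shortened word is one in `π` as well.
avoids-removeLast : ∀ p (π : Permutation′ (suc n)) → π Avoids p → removeLast π Avoids p
avoids-removeLast p π avoids c with contains⇒occurrence (removeLast π) p c
... | i , j , k , pos , iso = avoids (occurrence⇒contains π p
  ( inject₁ i , inject₁ j , inject₁ k
  , subst (λ A → A) (sym (positions-inject₁ p i j k)) pos
  , iso′))
  where
  iso′ : OrderIsomorphic (map toℕ (map (π ⟨$⟩ʳ_) (map inject₁ (i ∷ j ∷ k ∷ [])))) (letters p)
  iso′ rewrite removeLast-inject₁ π i | removeLast-inject₁ π j | removeLast-inject₁ π k =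
    Equivalence.from (OrderIsomorphic-punchIn _ (map (removeLast π ⟨$⟩ʳ_) (i ∷ j ∷ k ∷ [])) {letters p}) iso

-- An occurrence that does not use the new entry is already one in `π`. The new entry stands last,
-- so it can only play the third letter; this is the one case left as a hypothesis.
avoids-insertLast : ∀ p v (π : Permutation′ n) → π Avoids p →
  (∀ i j → Positions p (toℕ i) (toℕ j) n →
    ¬ OrderIsomorphic (map toℕ (punchIn v (π ⟨$⟩ʳ i) ∷ (punchIn v (π ⟨$⟩ʳ j) ∷ v ∷ []))) (letters p)) →
  insertLast v π Avoids p
avoids-insertLast {n} p v π avoids avoidsAtEnd c
  with contains⇒occurrence (insertLast v π) p c
... | i , j , k , pos , iso with view i | view j | view k
... | ‵fromℕ | _ | _ =
  contradiction (ℕ.<-≤-trans (proj₁ (positions-< p pos)) (≤fromℕ j)) (ℕ.<-irrefl refl)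
... | ‵inject₁ _ | ‵fromℕ | _ =
  contradiction (ℕ.<-≤-trans (proj₂ (positions-< p pos)) (≤fromℕ k)) (ℕ.<-irrefl refl)
... | ‵inject₁ i | ‵inject₁ j | ‵fromℕ
  rewrite insertLast-inject₁ v π i | insertLast-inject₁ v π j | insertLast-last v π
        | toℕ-inject₁ i | toℕ-inject₁ j | toℕ-fromℕ n
  = avoidsAtEnd i j pos iso
... | ‵inject₁ i | ‵inject₁ j | ‵inject₁ k
  rewrite insertLast-inject₁ v π i | insertLast-inject₁ v π j | insertLast-inject₁ v π k
  = avoids (occurrence⇒contains π p
  ( i , j , k
  , subst (λ A → A) (positions-inject₁ p i j k) pos
  , Equivalence.to (OrderIsomorphic-punchIn v (map (π ⟨$⟩ʳ_) (i ∷ j ∷ k ∷ [])) {letters p}) iso))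

-- Tilings

data Tiling : ℕ → Set where
  []     : Tiling 0
  square : Tiling n → Tiling (suc n)
  domino : Tiling n → Tiling (suc (suc n))

tiling↔fin : ∀ n → Tiling n ↔ Fin (F n)
-- The value 1 of `F` at 0 counts the empty tiling.
tiling↔fin zero = mk↔ₛ′ (λ _ → zero) (λ _ → []) (λ { zero → refl }) (λ { [] → refl })
tiling↔fin (suc zero) =
  mk↔ₛ′ (λ _ → zero) (λ _ → square []) (λ { zero → refl }) (λ { (square []) → refl })
tiling↔fin (suc (suc n)) =
  ↔-trans lastTile (↔-trans (tiling↔fin (suc n) ⊎-↔ tiling↔fin n) (↔-sym +↔⊎))
  where
  lastTile : Tiling (suc (suc n)) ↔ (Tiling (suc n) ⊎ Tiling n)
  lastTile = mk↔ₛ′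
    (λ { (square t) → inj₁ t ; (domino t) → inj₂ t })
    (λ { (inj₁ t) → square t ; (inj₂ t) → domino t })
    (λ { (inj₁ t) → refl ; (inj₂ t) → refl })
    (λ { (square t) → refl ; (domino t) → refl })

-- A condition on one pattern at a time, so that the ten sets can share its proofs. A domino is
-- inserted as 0 and then `m`; hence `domino-avoids` starts from a word that already ends in 0.
record Extendable (m : ∀ n → Fin (suc (suc n))) (p : Pattern) : Set where
  field
    square-avoids : {π : Permutation′ n} → π Avoids p → insertLast zero π Avoids p
    domino-avoids : {π : Permutation′ (suc n)} → π ⟨$⟩ʳ fromℕ n ≡ zero →
                    π Avoids p → insertLast (m n) π Avoids p

open Extendable

penultimate : ∀ n → Fin (suc (suc n))
penultimate n = inject₁ (fromℕ n)

Ending : (m : ∀ n → Fin (suc (suc n))) → Permutation′ (suc (suc n)) → Set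
Ending {n} m π =
  π ⟨$⟩ʳ fromℕ (suc n) ≡ zero ⊎
  (π ⟨$⟩ʳ fromℕ (suc n) ≡ m n × π ⟨$⟩ʳ penultimate n ≡ zero)

punchIn-≡0 : ∀ (v : Fin (suc (suc n))) x → punchIn v x ≡ zero → x ≡ zero
punchIn-≡0 (suc v) zero _ = refl

-- A square stands for a final entry 0, a domino for the final entries 0 m.
module Coding
  (m      : ∀ n → Fin (suc (suc n)))
  (m≢0    : ∀ n → m n ≢ zero)
  (extend : All (Extendable m) P)
  (ending : ∀ {n} (π : Permutation′ (suc (suc n))) → All (π Avoids_) P → Ending m π)
  where

  ⟦_⟧ : Tiling n → Permutation′ n
  ⟦ [] ⟧               = id
  ⟦ square t ⟧         = insertLast zero ⟦ t ⟧
  ⟦ domino {n = n} t ⟧ = insertLast (m n) (insertLast zero ⟦ t ⟧)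

  ⟦⟧-avoids : (t : Tiling n) → Extendable m p → ⟦ t ⟧ Avoids p
  ⟦⟧-avoids {p = p} [] ext c with contains⇒occurrence id p c
  ... | () , _
  ⟦⟧-avoids (square t) ext = square-avoids ext (⟦⟧-avoids t ext)
  ⟦⟧-avoids (domino t) ext =
    domino-avoids ext (insertLast-last zero ⟦ t ⟧) (square-avoids ext (⟦⟧-avoids t ext))

  -- The last entry reveals the last tile: it is 0 after a square and `m`, which is not 0, after a
  -- domino.
  ⟦⟧-injective : (s t : Tiling n) → ⟦ s ⟧ ≈ ⟦ t ⟧ → s ≡ t
  ⟦⟧-injective []         []         _  = refl
  ⟦⟧-injective (square s) (square t) eq = cong square
    (⟦⟧-injective s t (proj₂ (insertLast-injective {π = ⟦ s ⟧} {⟦ t ⟧} eq)))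
  ⟦⟧-injective (square s) (domino t) eq = contradiction
    (sym (proj₁ (insertLast-injective {π = ⟦ s ⟧} {insertLast zero ⟦ t ⟧} eq))) (m≢0 _)
  ⟦⟧-injective (domino s) (square t) eq = contradiction
    (proj₁ (insertLast-injective {π = insertLast zero ⟦ s ⟧} {⟦ t ⟧} eq)) (m≢0 _)
  ⟦⟧-injective (domino s) (domino t) eq = cong domino
    (⟦⟧-injective s t (proj₂ (insertLast-injective {π = ⟦ s ⟧} {⟦ t ⟧}
      (proj₂ (insertLast-injective {π = insertLast zero ⟦ s ⟧} {insertLast zero ⟦ t ⟧} eq)))))

  addTile : ∀ {π : Permutation′ (suc (suc n))} → Ending m π →
    ∃[ t ] ⟦ t ⟧ ≈ removeLast π → ∃[ t ] ⟦ t ⟧ ≈ removeLast (removeLast π) →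
    ∃[ t ] ⟦ t ⟧ ≈ π
  addTile {π = π} (inj₁ last≡0) (t , t≈) _ =
    square t , insertLast-removeLast π {⟦ t ⟧} last≡0 t≈
  addTile {n} {π} (inj₂ (last≡m , pen≡0)) _ (t , t≈) = domino t ,
    insertLast-removeLast π {insertLast zero ⟦ t ⟧} last≡m
      (insertLast-removeLast (removeLast π) {⟦ t ⟧} last′≡0 t≈)
    where
    -- Once the final `m` is deleted, the penultimate 0 becomes the last entry, and standardising
    -- keeps it 0.
    last′≡0 : removeLast π ⟨$⟩ʳ fromℕ n ≡ zero
    last′≡0 = punchIn-≡0 _ _ (trans (sym (removeLast-inject₁ π (fromℕ n))) pen≡0)

  ⟦⟧-surjective : ∀ n (π : Permutation′ n) → All (π Avoids_) P → ∃[ t ] ⟦ t ⟧ ≈ π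
  ⟦⟧-surjective zero π avoids = [] , λ ()
  ⟦⟧-surjective (suc zero) π avoids = square [] , λ i → only (⟦ square [] ⟧ ⟨$⟩ʳ i) (π ⟨$⟩ʳ i)
    where
    only : (x y : Fin 1) → x ≡ y
    only zero zero = refl
  ⟦⟧-surjective (suc (suc n)) π avoids = addTile (ending π avoids)
    (⟦⟧-surjective (suc n) (removeLast π) avoids′)
    (⟦⟧-surjective n (removeLast (removeLast π))
      (All.map (λ {p} → avoids-removeLast p (removeLast π)) avoids′))
    where
    avoids′ : All (removeLast π Avoids_) P
    avoids′ = All.map (λ {p} → avoids-removeLast p π) avoids

  cardinality : ∀ n → HasCardinality (S n P) (F n)
  cardinality n = Composition.inverse (Symmetry.inverse (Bijection⇒Inverse coding)) (tiling↔fin n)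
    where
    coding : Bijection (setoid (Tiling n)) (S n P)
    coding = record
      { to        = λ t → ⟦ t ⟧ , All.map (⟦⟧-avoids t) extend
      ; cong      = λ { refl _ → refl }
      ; bijective = (λ {s} {t} → ⟦⟧-injective s t)
                  , λ (π , avoids) → let t , t≈π = ⟦⟧-surjective n π avoids in
                      t , λ { refl → t≈π }
      }

-- Extending avoidance to a larger permutation

first second third : Pattern → ℕ
first  p = lookup (letters p) 0F
second p = lookup (letters p) 1F
third  p = lookup (letters p) 2F

perm-injective : ∀ (π : Permutation′ n) {i j} → π ⟨$⟩ʳ i ≡ π ⟨$⟩ʳ j → i ≡ j
perm-injective π eq = trans (sym (inverseˡ π)) (trans (cong (π ⟨$⟩ˡ_) eq) (inverseˡ π))

value-≢ : ∀ (π : Permutation′ n) {i j} → i ≢ j → toℕ (π ⟨$⟩ʳ i) ≢ toℕ (π ⟨$⟩ʳ j)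
value-≢ π i≢j = i≢j ∘ perm-injective π ∘ toℕ-injective

one top : ∀ n → Fin (suc (suc n))
one n = 1F
top n = fromℕ (suc n)

punchIn-one-<1 : ∀ (x : Fin (suc n)) → punchIn (one n) x Fin.< one n → x ≡ zero
punchIn-one-<1 zero    _         = refl
punchIn-one-<1 (suc x) (s≤s ())

-- A final 0 exceeds nothing, so it cannot play a third letter larger than the first. A final 1
-- exceeds only the 0 just before it, and that 0 stands too late to play the first letter, since the
-- second must fit in between.
extendable-one : ∀ p → first p < third p → Extendable one p
extendable-one p a<c .square-avoids {π = π} avoids =
  avoids-insertLast p zero π avoids λ i j _ iso → ℕ.n≮0 (Equivalence.from (iso 0F 2F) a<c)
extendable-one p a<c .domino-avoids {π = π} last≡0 avoids =
  avoids-insertLast p 1F π avoids λ i j pos iso →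
    let i<j , _ = positions-< p pos
        i≡last  = perm-injective π
          (trans (punchIn-one-<1 _ (Equivalence.from (iso 0F 2F) a<c)) (sym last≡0))
    in ℕ.<⇒≱ i<j (subst (j Fin.≤_) (sym i≡last) (≤fromℕ j))

ThirdBetween : Pattern → Set
ThirdBetween p = first p < third p × third p < second p ⊎ second p < third p × third p < first p

-- The appended entry is the least or the greatest of the word, whereas the third letter lies
-- strictly between the other two.
extendable-top-between : ∀ p → ThirdBetween p → Extendable top p
extendable-top-between p between .square-avoids {π = π} avoids =
  avoids-insertLast p zero π avoids λ i j _ iso → below between iso
  where
  below : ∀ {x y} → ThirdBetween p → ¬ OrderIsomorphic (x ∷ y ∷ 0 ∷ []) (letters p)
  below (inj₁ (a<c , _)) iso = ℕ.n≮0 (Equivalence.from (iso 0F 2F) a<c)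
  below (inj₂ (b<c , _)) iso = ℕ.n≮0 (Equivalence.from (iso 1F 2F) b<c)
extendable-top-between p between .domino-avoids {n} {π} _ avoids =
  avoids-insertLast p (top n) π avoids λ i j _ iso → above between iso
  where
  above : ∀ {x y : Fin (suc (suc n))} →
    ThirdBetween p → ¬ OrderIsomorphic (toℕ x ∷ toℕ y ∷ toℕ (top n) ∷ []) (letters p)
  above {y = y} (inj₁ (_ , c<b)) iso = ℕ.<⇒≱ (Equivalence.from (iso 2F 1F) c<b) (≤fromℕ y)
  above {x}     (inj₂ (_ , c<a)) iso = ℕ.<⇒≱ (Equivalence.from (iso 2F 0F) c<a) (≤fromℕ x)

-- A final maximum can play the 3, but adjacency then makes the 0 before it play the 2, leaving no
-- smaller entry for the 1.
extendable-top-1-23 : Extendable top 1-23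
extendable-top-1-23 .square-avoids {π = π} avoids =
  avoids-insertLast 1-23 zero π avoids λ i j _ iso →
    ℕ.n≮0 (Equivalence.from (iso 0F 2F) (from-yes (1 ℕ.<? 3)))
extendable-top-1-23 .domino-avoids {n} {π} last≡0 avoids =
  avoids-insertLast 1-23 (top n) π avoids λ i j (_ , n≡1+j) iso →
    -- The new entry has position `suc n`, so the adjacent `j` is the last position of `π`.
    let j≡last = toℕ-injective (trans (sym (ℕ.suc-injective n≡1+j)) (sym (toℕ-fromℕ n)))
        y≡0    = cong (toℕ ∘ punchIn (top n)) (trans (cong (π ⟨$⟩ʳ_) j≡last) last≡0)
    in ℕ.n≮0 (subst (toℕ (punchIn (top n) (π ⟨$⟩ʳ i)) <_) y≡0
                (Equivalence.from (iso 0F 1F) (from-yes (1 ℕ.<? 2))))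

-- The last two entries

module _ {n} (π : Permutation′ (suc (suc n))) where

  private
    last pen : Fin (suc (suc n))
    last = fromℕ (suc n)
    pen  = penultimate n

    value : Fin (suc (suc n)) → ℕ
    value i = toℕ (π ⟨$⟩ʳ i)

  last≡1+pen : toℕ last ≡ suc (toℕ pen)
  last≡1+pen = cong suc (sym (toℕ-inject₁ (fromℕ n)))

  location : ∀ v → π ⟨$⟩ʳ last ≡ v ⊎ π ⟨$⟩ʳ pen ≡ v ⊎ ∃[ i ] i Fin.< pen × π ⟨$⟩ʳ i ≡ v
  location v with π ⟨$⟩ˡ v | inverseʳ π {v}
  ... | i | eq with view i
  ...   | ‵fromℕ = inj₁ eq
  ...   | ‵inject₁ i′ with view i′
  ...     | ‵fromℕ     = inj₂ (inj₁ eq)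
  ...     | ‵inject₁ j = inj₂ (inj₂ (inject₁ (inject₁ j) , lt , eq))
    where
    lt : inject₁ (inject₁ j) Fin.< inject₁ (fromℕ n)
    lt rewrite toℕ-inject₁ (inject₁ j) | toℕ-inject₁ (fromℕ n) | toℕ-fromℕ n = inject₁ℕ< j

  pen<last : pen Fin.< last
  pen<last = ℕ.≤-reflexive (sym last≡1+pen)

  minimum-< : ∀ {i j} → π ⟨$⟩ʳ i ≡ zero → i ≢ j → value i < value j
  minimum-< {j = j} πi≡0 i≢j =
    ℕ.≤∧≢⇒< (subst (_≤ value j) (cong toℕ (sym πi≡0)) z≤n) (value-≢ π i≢j)

  -- An earlier 0 would play the 1, with the last two entries as 23 or 32 according to their order.
  minimum-late : π Avoids 1-23 → π Avoids 1-32 → π ⟨$⟩ʳ last ≡ zero ⊎ π ⟨$⟩ʳ pen ≡ zero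
  minimum-late no1-23 no1-32 with location zero
  ... | inj₁ eq = inj₁ eq
  ... | inj₂ (inj₁ eq) = inj₂ eq
  ... | inj₂ (inj₂ (i , i<pen , πi≡0)) with ℕ.<-cmp (value pen) (value last)
  ...   | tri< lt _ _ = contradiction
    (i , pen , last , i<pen , last≡1+pen ,
     arrangement (minimum-< πi≡0 (<⇒≢ i<pen)) lt (0F ∷ 1F ∷ 2F ∷ [])) no1-23
  ...   | tri≈ _ eq _ = contradiction eq (value-≢ π (<⇒≢ pen<last))
  ...   | tri> _ _ gt = contradiction
    (i , pen , last , i<pen , last≡1+pen ,
     arrangement (minimum-< πi≡0 (<⇒≢ (<-trans i<pen pen<last))) gt (0F ∷ 2F ∷ 1F ∷ [])) no1-32

  -- With 0 penultimate, an earlier entry 1 would form 2-13 with the last two entries.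
  ending-one : π Avoids 1-23 → π Avoids 1-32 → π Avoids 2-13 → Ending one π
  ending-one no1-23 no1-32 no2-13 with minimum-late no1-23 no1-32
  ... | inj₁ last≡0 = inj₁ last≡0
  ... | inj₂ pen≡0 with location 1F
  ...   | inj₁ last≡1 = inj₂ (last≡1 , pen≡0)
  ...   | inj₂ (inj₁ pen≡1) = contradiction (trans (sym pen≡0) pen≡1) λ ()
  ...   | inj₂ (inj₂ (i , i<pen , πi≡1)) = contradiction
    (i , pen , last , i<pen , last≡1+pen ,
     arrangement (minimum-< pen≡0 (<⇒≢ i<pen ∘ sym)) 1<last (1F ∷ 0F ∷ 2F ∷ [])) no2-13
    where
    -- The last entry is not the 0, hence at least 1; it is not the 1 either, which stands at `i`.
    1<last : value i < value last
    1<last = ℕ.≤∧≢⇒<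
      (subst (λ x → toℕ x ≤ value last) (sym πi≡1)
        (ℕ.≤-<-trans z≤n (minimum-< pen≡0 (<⇒≢ pen<last))))
      (value-≢ π (<⇒≢ (<-trans i<pen pen<last)))

  -- With 0 penultimate, an earlier maximum would form 3-12 with the last two entries.
  ending-top : π Avoids 1-23 → π Avoids 1-32 → π Avoids 3-12 → Ending top π
  ending-top no1-23 no1-32 no3-12 with minimum-late no1-23 no1-32
  ... | inj₁ last≡0 = inj₁ last≡0
  ... | inj₂ pen≡0 with location (top n)
  ...   | inj₁ last≡top = inj₂ (last≡top , pen≡0)
  ...   | inj₂ (inj₁ pen≡top) = contradiction (trans (sym pen≡0) pen≡top) λ ()
  ...   | inj₂ (inj₂ (i , i<pen , πi≡top)) = contradiction
    (i , pen , last , i<pen , last≡1+pen ,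
     arrangement (minimum-< pen≡0 (<⇒≢ pen<last)) last<top (2F ∷ 0F ∷ 1F ∷ [])) no3-12
    where
    last<top : value last < value i
    last<top = ℕ.≤∧≢⇒<
      (subst (λ x → value last ≤ toℕ x) (sym πi≡top) (≤fromℕ (π ⟨$⟩ʳ last)))
      (value-≢ π (<⇒≢ (<-trans i<pen pen<last) ∘ sym))

-- Implications between patterns

-- A discrete intermediate value principle: moving right from `i`, either `Q` still holds or a
-- crossing has been found. The bound `t Fin.≤ j` keeps the pair to the left of the third letter in
-- the applications.
crossing : ∀ {ℓ} {Q : Pred (Fin n) ℓ} → Decidable Q → ∀ {i j} → i Fin.≤ j → Q i → ¬ Q j →
  ∃[ s ] ∃[ t ] toℕ t ≡ suc (toℕ s) × t Fin.≤ j × Q s × ¬ Q t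
crossing {n = suc n} {Q = Q} Q? {i} {j} i≤j Qi ¬Qj = result
  (<-weakInduction-startingFrom (λ j → Q j ⊎ Crossing j) (inj₁ Qi) step i≤j)
  where
  Crossing : Fin (suc n) → Set _
  Crossing j = ∃[ s ] ∃[ t ] toℕ t ≡ suc (toℕ s) × t Fin.≤ j × Q s × ¬ Q t

  step : ∀ j → Q (inject₁ j) ⊎ Crossing (inject₁ j) → Q (suc j) ⊎ Crossing (suc j)
  step j (inj₂ (s , t , adj , t≤j , Qs , ¬Qt)) =
    inj₂ (s , t , adj , ℕ.m≤n⇒m≤1+n (subst (toℕ t ≤_) (toℕ-inject₁ j) t≤j) , Qs , ¬Qt)
  step j (inj₁ Qj) with Q? (suc j)
  ... | yes Qj+1 = inj₁ Qj+1
  ... | no ¬Qj+1 =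
    inj₂ (inject₁ j , suc j , cong suc (sym (toℕ-inject₁ j)) , ℕ.≤-refl , Qj , ¬Qj+1)

  result : Q j ⊎ Crossing j → Crossing j
  result (inj₁ Qj) = contradiction Qj ¬Qj
  result (inj₂ c)  = c

module _ (π : Permutation′ n) where

  private
    value : Fin n → ℕ
    value i = toℕ (π ⟨$⟩ʳ i)

  -- Between the 1 and the 3 of a 1-32 the word rises past the value of the 2 in a single step; that
  -- step and the 2 form 13-2.
  1-32-from-13-2 : π Avoids 13-2 → π Avoids 1-32
  1-32-from-13-2 no13-2 (i , j , k , i<j , k≡1+j , iso)
    with crossing (λ s → value s ℕ.<? value k) (ℕ.<⇒≤ i<j)
           (Equivalence.from (iso 0F 2F) (from-yes (1 ℕ.<? 2)))
           (ℕ.<⇒≯ (Equivalence.from (iso 2F 1F) (from-yes (2 ℕ.<? 3))))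
  ... | s , t , adj , t≤j , s<k , t≮k = no13-2
    (s , t , k , adj , t<k ,
     arrangement s<k (ℕ.≤∧≢⇒< (ℕ.≮⇒≥ t≮k) (value-≢ π (<⇒≢ t<k) ∘ sym)) (0F ∷ 2F ∷ 1F ∷ []))
    where
    t<k : t Fin.< k
    t<k = ℕ.≤-<-trans t≤j (ℕ.≤-reflexive (sym k≡1+j))

  -- Upside down, the same argument: between the 3 and the 1 the word drops past the value of the 2
  -- in a single step.
  3-12-from-31-2 : π Avoids 31-2 → π Avoids 3-12
  3-12-from-31-2 no31-2 (i , j , k , i<j , k≡1+j , iso)
    with crossing (λ s → value k ℕ.<? value s) (ℕ.<⇒≤ i<j)
           (Equivalence.from (iso 2F 0F) (from-yes (2 ℕ.<? 3)))
           (ℕ.<⇒≯ (Equivalence.from (iso 1F 2F) (from-yes (1 ℕ.<? 2))))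
  ... | s , t , adj , t≤j , k<s , k≮t = no31-2
    (s , t , k , adj , t<k ,
     arrangement (ℕ.≤∧≢⇒< (ℕ.≮⇒≥ k≮t) (value-≢ π (<⇒≢ t<k))) k<s (2F ∷ 0F ∷ 1F ∷ []))
    where
    t<k : t Fin.< k
    t<k = ℕ.≤-<-trans t≤j (ℕ.≤-reflexive (sym k≡1+j))

  -- The word leaves the interval of values between b and c either downwards,
  -- which gives 21-3, or upwards, which gives 13-2.
  2-13-from-21-3 : π Avoids 21-3 → π Avoids 13-2 → π Avoids 2-13
  2-13-from-21-3 no21-3 no13-2 (i , j , k , i<j , k≡1+j , iso)
    with crossing (λ s → (value i ℕ.≤? value s) ×-dec (value s ℕ.<? value k)) (ℕ.<⇒≤ i<j)
           (ℕ.≤-refl , Equivalence.from (iso 0F 2F) (from-yes (2 ℕ.<? 3)))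
           (ℕ.<⇒≱ (Equivalence.from (iso 1F 0F) (from-yes (1 ℕ.<? 2))) ∘ proj₁)
  ... | s , t , adj , t≤j , (i≤s , s<k) , t∉ with value i ℕ.≤? value t
  ...   | no i≰t = no21-3
    (s , t , k , adj , ℕ.≤-<-trans t≤j (ℕ.≤-reflexive (sym k≡1+j)) ,
     arrangement (ℕ.<-≤-trans (ℕ.≰⇒> i≰t) i≤s) s<k (1F ∷ 0F ∷ 2F ∷ []))
  ...   | yes i≤t = no13-2
    (s , t , k , adj , t<k ,
     arrangement s<k (ℕ.≤∧≢⇒< (ℕ.≮⇒≥ (t∉ ∘ (i≤t ,_))) (value-≢ π (<⇒≢ t<k) ∘ sym)) (0F ∷ 2F ∷ 1F ∷ []))
    where
    t<k : t Fin.< k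
    t<k = ℕ.≤-<-trans t≤j (ℕ.≤-reflexive (sym k≡1+j))

-- The ten sets

a<c? : Decidable (λ p → first p < third p)
a<c? p = first p ℕ.<? third p

thirdBetween? : Decidable ThirdBetween
thirdBetween? p = (first p ℕ.<? third p ×-dec third p ℕ.<? second p)
            ⊎-dec (second p ℕ.<? third p ×-dec third p ℕ.<? first p)

-- For a concrete `P` the condition on its letters is settled by evaluation, so each set has only to
-- supply, through `core`, the three patterns that force the ending.
cardinality-one : {_ : True (all? a<c? P)} →
  (∀ {n} (π : Permutation′ n) → All (π Avoids_) P →
    π Avoids 1-23 × π Avoids 1-32 × π Avoids 2-13) →
  ∀ n → 1 ≤ n → HasCardinality (S n P) (F n)
cardinality-one {_} {a<c} core n _ =
  Coding.cardinality one (λ _ ()) (All.map (extendable-one _) (toWitness a<c))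
    (λ π avoids → let no1-23 , no1-32 , no2-13 = core π avoids in
      ending-one π no1-23 no1-32 no2-13) n

-- The pattern 1-23 is split off because its third letter is the largest; all other patterns of
-- these four sets end in the letter 2.
cardinality-top : {_ : True (all? thirdBetween? P)} →
  (∀ {n} (π : Permutation′ n) → All (π Avoids_) (1-23 ∷ P) →
    π Avoids 1-23 × π Avoids 1-32 × π Avoids 3-12) →
  ∀ n → 1 ≤ n → HasCardinality (S n (1-23 ∷ P)) (F n)
cardinality-top {_} {between} core n _ =
  Coding.cardinality top (λ _ ())
    (extendable-top-1-23 ∷ All.map (extendable-top-between _) (toWitness between))
    (λ π avoids → let no1-23 , no1-32 , no3-12 = core π avoids in
      ending-top π no1-23 no1-32 no3-12) n

mainTheorem2 : All (λ P → ∀ (n : ℕ) → 1 ≤ n → HasCardinality (S n P) (F n))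
    ( (1-23 ∷ 2-13 ∷ 1-32 ∷ 21-3 ∷ [])
    ∷ (1-23 ∷ 2-13 ∷ 1-32 ∷ 12-3 ∷ [])
    ∷ (1-23 ∷ 2-13 ∷ 13-2 ∷ 21-3 ∷ [])
    ∷ (1-23 ∷ 2-13 ∷ 13-2 ∷ 1-32 ∷ [])
    ∷ (1-23 ∷ 2-13 ∷ 13-2 ∷ 12-3 ∷ [])
    ∷ (1-23 ∷ 21-3 ∷ 13-2 ∷ 1-32 ∷ [])
    ∷ (1-23 ∷ 13-2 ∷ 3-12 ∷ 1-32 ∷ [])
    ∷ (1-23 ∷ 1-32 ∷ 31-2 ∷ 3-12 ∷ [])
    ∷ (1-23 ∷ 13-2 ∷ 31-2 ∷ 1-32 ∷ [])
    ∷ (1-23 ∷ 13-2 ∷ 31-2 ∷ 3-12 ∷ [])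
    ∷ [])
mainTheorem2
  = cardinality-one (λ { _ (no1-23 ∷ no2-13 ∷ no1-32 ∷ _) → no1-23 , no1-32 , no2-13 })
  ∷ cardinality-one (λ { _ (no1-23 ∷ no2-13 ∷ no1-32 ∷ _) → no1-23 , no1-32 , no2-13 })
  ∷ cardinality-one (λ { π (no1-23 ∷ no2-13 ∷ no13-2 ∷ _) →
      no1-23 , 1-32-from-13-2 π no13-2 , no2-13 })
  ∷ cardinality-one (λ { _ (no1-23 ∷ no2-13 ∷ _ ∷ no1-32 ∷ _) → no1-23 , no1-32 , no2-13 })
  ∷ cardinality-one (λ { π (no1-23 ∷ no2-13 ∷ no13-2 ∷ _) →
      no1-23 , 1-32-from-13-2 π no13-2 , no2-13 })
  ∷ cardinality-one (λ { π (no1-23 ∷ no21-3 ∷ no13-2 ∷ no1-32 ∷ _) →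
      no1-23 , no1-32 , 2-13-from-21-3 π no21-3 no13-2 })
  ∷ cardinality-top (λ { _ (no1-23 ∷ _ ∷ no3-12 ∷ no1-32 ∷ _) → no1-23 , no1-32 , no3-12 })
  ∷ cardinality-top (λ { _ (no1-23 ∷ no1-32 ∷ _ ∷ no3-12 ∷ _) → no1-23 , no1-32 , no3-12 })
  ∷ cardinality-top (λ { π (no1-23 ∷ _ ∷ no31-2 ∷ no1-32 ∷ _) →
      no1-23 , no1-32 , 3-12-from-31-2 π no31-2 })
  ∷ cardinality-top (λ { π (no1-23 ∷ no13-2 ∷ _ ∷ no3-12 ∷ _) →
      no1-23 , 1-32-from-13-2 π no13-2 , no3-12 })
  ∷ []
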